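{- Let $p$ be a prime and $f\ge1$. Suppose that $r_0,\dots,r_{f-1}$ are integers in the range $[-p,p]$ satisfying $\sum_{i=0}^{f-1}p^{f-1-i}r_i\equiv0\pmod{p^f-1}$. Then either: (1) $(r_0,\dots,r_{f-1})=\pm(p-1,\dots,p-1)$; (2) the numbers $r_0,\dots,r_{f-1}$, considered as a cyclic list, can be broken up into strings of the form $\pm(-1,p-1,\dots,p-1,p)$ (where there may be no occurrences of $p-1$) and strings of the form $(0,\dots,0)$; or (3) $p=2$ and $(r_0,\dots,r_{f-1})=\pm(2,\dots,2)$. -}

module Defs where

open import Data.Nat as ℕ using (ℕ; suc; _∸_; _^_)
open import Data.Integer as ℤ using (ℤ; +_; -_; _*_; _+_)
open import Data.Fin using (Fin; toℕ)
open import Data.Vec as Vec using (Vec)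
open import Data.List using (List; []; _∷_; _++_; [_]; replicate; drop; take; concat; map)
open import Data.List.Relation.Unary.All using (All)
open import Data.Product using (Σ; ∃; _×_)
open import Relation.Binary.PropositionalEquality using (_≡_)

-- Σ_{i=0}^{f-1} p^{f-1-i} r_i
weightedSum : (p f : ℕ) → Vec ℤ f → ℤ
weightedSum p f r =
  Vec.foldr _ _+_ (+ 0) (Vec.tabulate {n = f} (λ i → (+ (p ^ (f ∸ 1 ∸ toℕ i))) * Vec.lookup r i))

-- cyclic rotation of a list by k positions
rotate : {A : Set} → ℕ → List A → List A
rotate k xs = drop k xs ++ take k xs

-- the string (-1, p-1, ..., p-1, p) with m copies of p-1
posString : ℕ → ℕ → List ℤ
posString p m = (- + 1) ∷ (replicate m (+ (p ∸ 1)) ++ [ + p ])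

-- admissible strings: ±(-1, p-1, ..., p-1, p) (possibly no p-1), or a nonempty string of zeros
data IsBlock (p : ℕ) : List ℤ → Set where
  plus  : (m : ℕ) → IsBlock p (posString p m)
  minus : (m : ℕ) → IsBlock p (map -_ (posString p m))
  zeros : (m : ℕ) → IsBlock p (replicate (suc m) (+ 0))

-- the list, read cyclically, can be broken up into admissible strings
CyclicBlockDecomposition : (p : ℕ) → List ℤ → Set
CyclicBlockDecomposition p xs =
  ∃ λ (k : ℕ) → ∃ λ (bs : List (List ℤ)) → All (IsBlock p) bs × concat bs ≡ rotate k xs

{-# OPTIONS --safe #-}
-- Read the digits r₀, …, r_{f-1} as a carry process c ↦ p·c − rᵢ.  After f steps from c the carry
-- is p^f·c − Σ p^{f-1-i} rᵢ, so the divisibility hypothesis says exactly that the process started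
-- at the quotient q returns to q.  Since |rᵢ| ≤ p, a carry c ≥ 2 can never decrease, and it stays
-- put only when p = 2 and rᵢ = 2 (symmetrically for c ≤ −2): this is case (3).  Otherwise every
-- carry lies in {−1, 0, 1}, and the only moves are 0 → 0 (digit 0), 0 → ±1 (digit ∓1),
-- ±1 → ±1 (digit ±(p−1)) and ±1 → 0 (digit ±p).  A closed walk in this automaton either stays at
-- ±1, which is case (1), or passes through 0; rotated to start there, it splits into the strings
-- of case (2).  Primality of p is used only through p ≥ 2.
module Submission where

open import Defs
open import Data.Nat as ℕ using (ℕ; _∸_)
open import Data.Nat.Primality using (Prime)
open import Data.Integer as ℤ using (ℤ; +_; -_; _≤_)
open import Data.Integer.Divisibility using (_∣_)
open import Data.Vec as Vec using (Vec; replicate; lookup; toList)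
open import Data.Fin using (Fin)
open import Data.Sum using (_⊎_)
open import Data.Product using (_×_)
open import Relation.Binary.PropositionalEquality using (_≡_)

open import Data.Nat using (zero; suc; z≤n; s≤s; NonZero; _^_)
import Data.Nat.Properties as ℕₚ
open import Data.Integer using (0ℤ; -[1+_]; +≤+; -≤-; _+_; _-_; _*_; _◃_)
import Data.Integer.Properties as ℤₚ
open import Data.Integer.Divisibility.Signed using (divides; ∣ᵤ⇒∣)
open import Data.Integer.Tactic.RingSolver using (solve-∀)
open import Data.Sign as Sign using (Sign)
open import Data.Fin using (toℕ)
open import Data.List as List using (List; []; _∷_; _++_; [_]; map; concat; length; drop; take)
import Data.List.Properties as Listₚ
open import Data.List.Relation.Unary.All as All using (All; []; _∷_)
import Data.List.Relation.Unary.All.Properties as Allₚ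
import Data.Vec.Properties as Vecₚ
import Data.Vec.Relation.Unary.All as VecAll
import Data.Vec.Relation.Unary.All.Properties as VecAllₚ
open import Data.Product as Product using (∃; ∃₂; _,_; proj₁; proj₂)
open import Data.Sum as Sum using (inj₁; inj₂)
open import Data.Empty using (⊥-elim)
open import Relation.Nullary using (¬_)
open import Relation.Binary.PropositionalEquality
  using (refl; sym; trans; cong; cong₂; subst; module ≡-Reasoning)

open ≡-Reasoning

drop-length-++ : {A : Set} (xs ys : List A) → drop (length xs) (xs ++ ys) ≡ ys
drop-length-++ []       ys = refl
drop-length-++ (x ∷ xs) ys = drop-length-++ xs ys

take-length-++ : {A : Set} (xs ys : List A) → take (length xs) (xs ++ ys) ≡ xs
take-length-++ []       ys = refl
take-length-++ (x ∷ xs) ys = cong (x ∷_) (take-length-++ xs ys)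

rotate-length-++ : {A : Set} (xs ys : List A) → rotate (length xs) (xs ++ ys) ≡ ys ++ xs
rotate-length-++ xs ys = cong₂ _++_ (drop-length-++ xs ys) (take-length-++ xs ys)

toList-All≡⇒replicate : ∀ {A : Set} {n} (v : Vec A n) {x} →
  All (_≡ x) (toList v) → v ≡ replicate n x
toList-All≡⇒replicate Vec.[]       []         = refl
toList-All≡⇒replicate (y Vec.∷ v) (y≡x ∷ v≡x) =
  cong₂ Vec._∷_ y≡x (toList-All≡⇒replicate v v≡x)

lookup-All⇒toList-All : ∀ {A : Set} {P : A → Set} {n} (v : Vec A n) →
  (∀ i → P (lookup v i)) → All P (toList v)
lookup-All⇒toList-All {P = P} v Pv =
  VecAllₚ.toList⁺ (subst (VecAll.All P) (Vecₚ.tabulate∘lookup v) (VecAllₚ.tabulate⁺ Pv))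

pos-∸ : ∀ {m n} → n ℕ.≤ m → + (m ∸ n) ≡ + m - + n
pos-∸ {m} {n} n≤m = trans (sym (ℤₚ.⊖-≥ n≤m)) (sym (ℤₚ.m-n≡m⊖n m n))

0≤i⇒0≤+m*i : ∀ m {i} → 0ℤ ≤ i → 0ℤ ≤ + m * i
0≤i⇒0≤+m*i m (+≤+ {n = n} _) = subst (0ℤ ≤_) (ℤₚ.pos-* m n) (+≤+ z≤n)

nonneg-sum≡0 : ∀ {i j} → 0ℤ ≤ i → 0ℤ ≤ j → i + j ≡ 0ℤ → i ≡ 0ℤ × j ≡ 0ℤ
nonneg-sum≡0 (+≤+ {n = m} _) (+≤+ {n = n} _) m+n≡0 =
  cong +_ (ℕₚ.m+n≡0⇒m≡0 m (ℤₚ.+-injective m+n≡0)) ,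
  cong +_ (ℕₚ.m+n≡0⇒n≡0 m (ℤₚ.+-injective m+n≡0))

weightedSum-∷ : ∀ p {n} x (v : Vec ℤ n) →
  weightedSum p (suc n) (x Vec.∷ v) ≡ + (p ^ n) * x + weightedSum p n v
weightedSum-∷ p {n} x v = cong (_+_ (+ (p ^ n) * x)) (cong (Vec.foldr _ _+_ 0ℤ) (Vecₚ.tabulate-cong
  λ i → cong (λ k → + (p ^ k) * lookup v i) (sym (ℕₚ.∸-+-assoc n 1 (toℕ i)))))

data SmallCarry : Set where
  zero : SmallCarry
  unit : Sign → SmallCarry

⟦_⟧ : SmallCarry → ℤ
⟦ zero ⟧   = 0ℤ
⟦ unit σ ⟧ = σ ◃ 1

⟦⟧-injective : ∀ {s t} → ⟦ s ⟧ ≡ ⟦ t ⟧ → s ≡ t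
⟦⟧-injective {zero}        {zero}        _ = refl
⟦⟧-injective {unit Sign.+} {unit Sign.+} _ = refl
⟦⟧-injective {unit Sign.-} {unit Sign.-} _ = refl
⟦⟧-injective {zero}        {unit Sign.+} ()
⟦⟧-injective {zero}        {unit Sign.-} ()
⟦⟧-injective {unit Sign.+} {zero}        ()
⟦⟧-injective {unit Sign.+} {unit Sign.-} ()
⟦⟧-injective {unit Sign.-} {zero}        ()
⟦⟧-injective {unit Sign.-} {unit Sign.+} ()

2≰⟦⟧ : ∀ s → ¬ (+ 2 ≤ ⟦ s ⟧)
2≰⟦⟧ zero          (+≤+ ())
2≰⟦⟧ (unit Sign.+) (+≤+ (s≤s ()))
2≰⟦⟧ (unit Sign.-) ()

⟦⟧≰-2 : ∀ s → ¬ (⟦ s ⟧ ≤ - + 2)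
⟦⟧≰-2 zero          ()
⟦⟧≰-2 (unit Sign.+) ()
⟦⟧≰-2 (unit Sign.-) (-≤- ())

large⊎small⊎⟦⟧ : ∀ c → + 2 ≤ c ⊎ c ≤ - + 2 ⊎ ∃ λ s → ⟦ s ⟧ ≡ c
large⊎small⊎⟦⟧ (+ 0)           = inj₂ (inj₂ (zero , refl))
large⊎small⊎⟦⟧ (+ 1)           = inj₂ (inj₂ (unit Sign.+ , refl))
large⊎small⊎⟦⟧ (+ suc (suc n)) = inj₁ (+≤+ (s≤s (s≤s z≤n)))
large⊎small⊎⟦⟧ -[1+ 0 ]        = inj₂ (inj₂ (unit Sign.- , refl))
large⊎small⊎⟦⟧ -[1+ suc n ]    = inj₂ (inj₁ (-≤- (s≤s z≤n)))

module CarryRun (p : ℕ) where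

  step : ℤ → ℤ → ℤ
  step c r = + p * c - r

  run : ℤ → List ℤ → ℤ
  run c []       = c
  run c (r ∷ rs) = run (step c r) rs

  step-neg : ∀ c r → step (- c) (- r) ≡ - step c r
  step-neg c r = identity (+ p) c r
    where
    identity : ∀ P c r → P * - c - - r ≡ - (P * c - r)
    identity = solve-∀

  run-neg : ∀ c rs → run (- c) (map -_ rs) ≡ - run c rs
  run-neg c []       = refl
  run-neg c (r ∷ rs) = trans (cong (λ d → run d (map -_ rs)) (step-neg c r)) (run-neg (step c r) rs)

  step-digit : ∀ c {r d} → step c r ≡ d → r ≡ + p * c - d
  step-digit c {r} refl = identity (+ p) c r
    where
    identity : ∀ P c r → r ≡ P * c - (P * c - r)
    identity = solve-∀

  run-toList : ∀ {n} (v : Vec ℤ n) c → run c (toList v) ≡ + (p ^ n) * c - weightedSum p n v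
  run-toList Vec.[] c = sym (identity c)
    where
    identity : ∀ c → + 1 * c - 0ℤ ≡ c
    identity = solve-∀
  run-toList {suc n} (x Vec.∷ v) c = begin
    run (step c x) (toList v)
      ≡⟨ run-toList v (step c x) ⟩
    + (p ^ n) * (+ p * c - x) - weightedSum p n v
      ≡⟨ horner (+ p) (+ (p ^ n)) c x (weightedSum p n v) ⟩
    + p * + (p ^ n) * c - (+ (p ^ n) * x + weightedSum p n v)
      ≡⟨ cong₂ (λ u w → u * c - w) (sym (ℤₚ.pos-* p (p ^ n))) (sym (weightedSum-∷ p x v)) ⟩
    + (p ^ suc n) * c - weightedSum p (suc n) (x Vec.∷ v) ∎
    where
    horner : ∀ P Q c x w → Q * (P * c - x) - w ≡ P * Q * c - (Q * x + w)
    horner = solve-∀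

  closed-run : .{{_ : NonZero p}} → ∀ {n} (v : Vec ℤ n) →
    + (p ^ n ∸ 1) ∣ weightedSum p n v → ∃ λ q → run q (toList v) ≡ q
  closed-run {n} v p^n-1∣sum with ∣ᵤ⇒∣ p^n-1∣sum
  ... | divides q sum≡q[p^n-1] = q , (begin
    run q (toList v)                      ≡⟨ run-toList v q ⟩
    + (p ^ n) * q - weightedSum p n v     ≡⟨ cong (_-_ (+ (p ^ n) * q)) sum≡q[p^n-1] ⟩
    + (p ^ n) * q - q * + (p ^ n ∸ 1)     ≡⟨ cong (λ m → + (p ^ n) * q - q * m)
                                                    (pos-∸ (ℕₚ.m^n>0 p n)) ⟩
    + (p ^ n) * q - q * (+ (p ^ n) - + 1) ≡⟨ identity (+ (p ^ n)) q ⟩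
    q                                     ∎)
    where
    identity : ∀ P q → P * q - q * (P - + 1) ≡ q
    identity = solve-∀

-- Parametrised by a = p − 2, so that p ≥ 2 holds definitionally.
module BoundedDigits (a : ℕ) where

  p : ℕ
  p = 2 ℕ.+ a

  open CarryRun p

  Bounded : ℤ → Set
  Bounded r = - + p ≤ r × r ≤ + p

  Bounded-neg : ∀ {r} → Bounded r → Bounded (- r)
  Bounded-neg (-p≤r , r≤p) = ℤₚ.neg-mono-≤ r≤p , ℤₚ.neg-mono-≤ -p≤r

  All-Bounded-neg : ∀ {rs} → All Bounded rs → All Bounded (map -_ rs)
  All-Bounded-neg bs = Allₚ.map⁺ (All.map Bounded-neg bs)

  step-excess : ∀ c r → step c r - c ≡ + a + + suc a * (c - + 2) + (+ p - r)
  step-excess c r = identity (+ a) c r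
    where
    identity : ∀ A c r → (+ 2 + A) * c - r - c ≡ A + (+ 1 + A) * (c - + 2) + ((+ 2 + A) - r)
    identity = solve-∀

  0≤[p-1][c-2] : ∀ {c} → + 2 ≤ c → 0ℤ ≤ + suc a * (c - + 2)
  0≤[p-1][c-2] 2≤c = 0≤i⇒0≤+m*i (suc a) (ℤₚ.i≤j⇒0≤j-i 2≤c)

  large-step-growth : ∀ {c r} → + 2 ≤ c → r ≤ + p → c ≤ step c r
  large-step-growth {c} {r} 2≤c r≤p = ℤₚ.0≤i-j⇒j≤i (subst (0ℤ ≤_) (sym (step-excess c r))
    (ℤₚ.+-mono-≤ (ℤₚ.+-mono-≤ (+≤+ z≤n) (0≤[p-1][c-2] 2≤c)) (ℤₚ.i≤j⇒0≤j-i r≤p)))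

  large-step-fixed : ∀ {c r} → + 2 ≤ c → r ≤ + p → step c r ≡ c → a ≡ 0 × r ≡ + p
  large-step-fixed {c} {r} 2≤c r≤p fixed
    with nonneg-sum≡0 (ℤₚ.+-mono-≤ (+≤+ z≤n) (0≤[p-1][c-2] 2≤c)) (ℤₚ.i≤j⇒0≤j-i r≤p)
           (trans (sym (step-excess c r)) (trans (cong (_- c) fixed) (ℤₚ.+-inverseʳ c)))
  ... | a+x≡0 , p-r≡0 =
    ℤₚ.+-injective (proj₁ (nonneg-sum≡0 (+≤+ z≤n) (0≤[p-1][c-2] 2≤c) a+x≡0)) ,
    sym (ℤₚ.i-j≡0⇒i≡j (+ p) r p-r≡0)

  large-run-growth : ∀ {c rs} → + 2 ≤ c → All Bounded rs → c ≤ run c rs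
  large-run-growth 2≤c []               = ℤₚ.≤-refl
  large-run-growth {c} {r ∷ rs} 2≤c ((_ , r≤p) ∷ bs) =
    ℤₚ.≤-trans growth (large-run-growth (ℤₚ.≤-trans 2≤c growth) bs)
    where
    growth : c ≤ step c r
    growth = large-step-growth 2≤c r≤p

  small-run-decay : ∀ {c rs} → c ≤ - + 2 → All Bounded rs → run c rs ≤ c
  small-run-decay {c} {rs} c≤-2 bs = ℤₚ.neg-cancel-≤
    (subst (- c ≤_) (run-neg c rs) (large-run-growth (ℤₚ.neg-mono-≤ c≤-2) (All-Bounded-neg bs)))

  large-closed-run-stationary : ∀ {c rs} → + 2 ≤ c → All Bounded rs → run c rs ≡ c →
    All (λ r → step c r ≡ c) rs
  large-closed-run-stationary 2≤c [] _ = []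
  large-closed-run-stationary {c} {r ∷ rs} 2≤c ((_ , r≤p) ∷ bs) loop =
    fixed ∷ large-closed-run-stationary 2≤c bs (subst (λ d → run d rs ≡ c) fixed loop)
    where
    growth : c ≤ step c r
    growth = large-step-growth 2≤c r≤p
    fixed : step c r ≡ c
    fixed = ℤₚ.≤-antisym
      (subst (step c r ≤_) loop (large-run-growth (ℤₚ.≤-trans 2≤c growth) bs)) growth

  large-closed-run-digits : ∀ {c r rs} → + 2 ≤ c → All Bounded (r ∷ rs) → run c (r ∷ rs) ≡ c →
    a ≡ 0 × All (_≡ + p) (r ∷ rs)
  large-closed-run-digits {c} {r} {rs} 2≤c bs loop =
    proj₁ (All.head fixed-digits) , All.map proj₂ fixed-digits
    where
    fixed-digits : All (λ r → a ≡ 0 × r ≡ + p) (r ∷ rs)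
    fixed-digits = All.zipWith (λ ((_ , r≤p) , fixed) → large-step-fixed 2≤c r≤p fixed)
                               (bs , large-closed-run-stationary 2≤c bs loop)

  small-closed-run-digits : ∀ {c r rs} → c ≤ - + 2 → All Bounded (r ∷ rs) → run c (r ∷ rs) ≡ c →
    a ≡ 0 × All (_≡ - + p) (r ∷ rs)
  small-closed-run-digits {c} {r} {rs} c≤-2 bs loop
    with large-closed-run-digits (ℤₚ.neg-mono-≤ c≤-2) (All-Bounded-neg bs)
                                 (trans (run-neg c (r ∷ rs)) (cong -_ loop))
  ... | a≡0 , negated = a≡0 , All.map neg-≡ (Allₚ.map⁻ negated)
    where
    neg-≡ : ∀ {x} → - x ≡ + p → x ≡ - + p
    neg-≡ {x} -x≡p = trans (sym (ℤₚ.neg-involutive x)) (cong -_ -x≡p)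

  data Step : SmallCarry → ℤ → SmallCarry → Set where
    idle  : Step zero 0ℤ zero
    enter : ∀ σ → Step zero (- (σ ◃ 1)) (unit σ)
    stay  : ∀ σ → Step (unit σ) (σ ◃ (p ∸ 1)) (unit σ)
    leave : ∀ σ → Step (unit σ) (σ ◃ p) zero

  step-sound : ∀ {s r t} → Step s r t → step ⟦ s ⟧ r ≡ ⟦ t ⟧
  step-sound idle           = identity (+ p)
    where
    identity : ∀ P → P * 0ℤ - 0ℤ ≡ 0ℤ
    identity = solve-∀
  step-sound (enter σ)      = identity (+ p) (σ ◃ 1)
    where
    identity : ∀ P x → P * 0ℤ - - x ≡ x
    identity = solve-∀
  step-sound (stay Sign.+)  = identity (+ a)
    where
    identity : ∀ A → (+ 2 + A) * + 1 - (+ 1 + A) ≡ + 1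
    identity = solve-∀
  step-sound (stay Sign.-)  = identity (+ a)
    where
    identity : ∀ A → (+ 2 + A) * - + 1 - - (+ 1 + A) ≡ - + 1
    identity = solve-∀
  step-sound (leave Sign.+) = identity (+ a)
    where
    identity : ∀ A → (+ 2 + A) * + 1 - (+ 2 + A) ≡ 0ℤ
    identity = solve-∀
  step-sound (leave Sign.-) = identity (+ a)
    where
    identity : ∀ A → (+ 2 + A) * - + 1 - - (+ 2 + A) ≡ 0ℤ
    identity = solve-∀

  Step-digit-determined : ∀ {s r₀ r t} → Step s r₀ t → step ⟦ s ⟧ r ≡ ⟦ t ⟧ → Step s r t
  Step-digit-determined {s} {t = t} st e =
    subst (λ r → Step s r t)
          (trans (step-digit ⟦ s ⟧ (step-sound st)) (sym (step-digit ⟦ s ⟧ e))) st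

  step-complete : ∀ {s r t} → Bounded r → step ⟦ s ⟧ r ≡ ⟦ t ⟧ → Step s r t
  step-complete {zero}        {t = zero}        _ = Step-digit-determined idle
  step-complete {zero}        {t = unit σ}      _ = Step-digit-determined (enter σ)
  step-complete {unit σ}      {t = zero}        _ = Step-digit-determined (leave σ)
  step-complete {unit Sign.+} {t = unit Sign.+} _ = Step-digit-determined (stay Sign.+)
  step-complete {unit Sign.-} {t = unit Sign.-} _ = Step-digit-determined (stay Sign.-)
  step-complete {unit Sign.+} {t = unit Sign.-} (_ , r≤p) e
    with subst (_≤ + p) (trans (step-digit (+ 1) e) (identity (+ a))) r≤p
    where
    identity : ∀ A → (+ 2 + A) * + 1 - - + 1 ≡ + 3 + A
    identity = solve-∀
  ... | +≤+ p+1≤p = ⊥-elim (ℕₚ.<-irrefl refl p+1≤p)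
  step-complete {unit Sign.-} {t = unit Sign.+} (-p≤r , _) e
    with subst (- + p ≤_) (trans (step-digit (- + 1) e) (identity (+ a))) -p≤r
    where
    identity : ∀ A → (+ 2 + A) * - + 1 - + 1 ≡ - (+ 3 + A)
    identity = solve-∀
  ... | -≤- p+1≤p = ⊥-elim (ℕₚ.<-irrefl refl p+1≤p)

  data Path : SmallCarry → List ℤ → SmallCarry → Set where
    []  : ∀ {s} → Path s [] s
    _∷_ : ∀ {s r t rs u} → Step s r t → Path t rs u → Path s (r ∷ rs) u

  _++ᴾ_ : ∀ {s xs t ys u} → Path s xs t → Path t ys u → Path s (xs ++ ys) u
  []         ++ᴾ path′ = path′
  (st ∷ path) ++ᴾ path′ = st ∷ (path ++ᴾ path′)

  carry-path : ∀ {s t} xs → All Bounded xs → run ⟦ s ⟧ xs ≡ ⟦ t ⟧ → Path s xs t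
  carry-path [] [] s≡t = subst (Path _ []) (⟦⟧-injective s≡t) []
  carry-path {s} {t} (r ∷ rs) (b ∷ bs) end with large⊎small⊎⟦⟧ (step ⟦ s ⟧ r)
  ... | inj₁ large =
    ⊥-elim (2≰⟦⟧ t (subst (+ 2 ≤_) end (ℤₚ.≤-trans large (large-run-growth large bs))))
  ... | inj₂ (inj₁ small) =
    ⊥-elim (⟦⟧≰-2 t (subst (_≤ - + 2) end (ℤₚ.≤-trans (small-run-decay small bs) small)))
  ... | inj₂ (inj₂ (u , ⟦u⟧≡)) =
    step-complete {s} {t = u} b (sym ⟦u⟧≡) ∷
    carry-path rs bs (subst (λ d → run d rs ≡ ⟦ t ⟧) (sym ⟦u⟧≡) end)

  signedString : Sign → ℕ → List ℤ
  signedString σ m = - (σ ◃ 1) ∷ (List.replicate m (σ ◃ (p ∸ 1)) ++ [ σ ◃ p ])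

  signedString-isBlock : ∀ σ m → IsBlock p (signedString σ m)
  signedString-isBlock Sign.+ m = plus m
  signedString-isBlock Sign.- m = subst (IsBlock p) negated (minus m)
    where
    negated : map -_ (posString p m) ≡ signedString Sign.- m
    negated = cong (+ 1 ∷_) (trans (Listₚ.map-++ -_ (List.replicate m (+ suc a)) [ + p ])
                                   (cong (_++ [ - + p ]) (Listₚ.map-replicate -_ m (+ suc a))))

  Blocks : List ℤ → Set
  Blocks xs = ∃ λ bs → All (IsBlock p) bs × concat bs ≡ xs

  blocks : ∀ {xs} → Path zero xs zero → Blocks xs
  string-tail : ∀ {σ xs} → Path (unit σ) xs zero →
    ∃₂ λ m ys → xs ≡ List.replicate m (σ ◃ (p ∸ 1)) ++ (σ ◃ p) ∷ ys × Blocks ys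

  blocks [] = [] , [] , refl
  blocks (idle ∷ path) with blocks path
  ... | bs , ok , refl = [ 0ℤ ] ∷ bs , zeros 0 ∷ ok , refl
  blocks (enter σ ∷ path) with string-tail path
  ... | m , ys , refl , (bs , ok , refl) =
    signedString σ m ∷ bs , signedString-isBlock σ m ∷ ok ,
    cong (- (σ ◃ 1) ∷_) (Listₚ.++-assoc (List.replicate m (σ ◃ (p ∸ 1))) [ σ ◃ p ] (concat bs))

  string-tail (stay σ ∷ path) with string-tail path
  ... | m , ys , refl , ys-blocks = suc m , ys , refl , ys-blocks
  string-tail (leave σ ∷ path) = 0 , _ , refl , blocks path

  stays⊎passes-zero : ∀ {σ xs} → Path (unit σ) xs (unit σ) →
    All (_≡ σ ◃ (p ∸ 1)) xs
    ⊎ ∃₂ λ as bs → xs ≡ as ++ bs × Path (unit σ) as zero × Path zero bs (unit σ)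
  stays⊎passes-zero [] = inj₁ []
  stays⊎passes-zero (stay σ ∷ path) with stays⊎passes-zero path
  ... | inj₁ stays = inj₁ (refl ∷ stays)
  ... | inj₂ (as , bs , refl , to-zero , from-zero) =
    inj₂ (_ ∷ as , bs , refl , stay σ ∷ to-zero , from-zero)
  stays⊎passes-zero (leave σ ∷ path) = inj₂ ([ σ ◃ p ] , _ , refl , leave σ ∷ [] , path)

  cyclic-decomposition : ∀ {s xs ys} → Path s xs zero → Path zero ys s →
    CyclicBlockDecomposition p (xs ++ ys)
  cyclic-decomposition {xs = xs} {ys} to-zero from-zero =
    length xs , subst Blocks (sym (rotate-length-++ xs ys)) (blocks (from-zero ++ᴾ to-zero))

  loop-classification : ∀ {s xs} → Path s xs s →
    (∃ λ σ → All (_≡ σ ◃ (p ∸ 1)) xs) ⊎ CyclicBlockDecomposition p xs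
  loop-classification {zero} path = inj₂ (cyclic-decomposition [] path)
  loop-classification {unit σ} path with stays⊎passes-zero path
  ... | inj₁ stays = inj₁ (σ , stays)
  ... | inj₂ (_ , _ , refl , to-zero , from-zero) = inj₂ (cyclic-decomposition to-zero from-zero)

  closed-run-classification : ∀ {c r rs} → All Bounded (r ∷ rs) → run c (r ∷ rs) ≡ c →
    (∃ λ σ → All (_≡ σ ◃ (p ∸ 1)) (r ∷ rs))
    ⊎ CyclicBlockDecomposition p (r ∷ rs)
    ⊎ (a ≡ 0 × ∃ λ σ → All (_≡ σ ◃ p) (r ∷ rs))
  closed-run-classification {c} bs loop with large⊎small⊎⟦⟧ c
  ... | inj₁ large =
    inj₂ (inj₂ (Product.map₂ (Sign.+ ,_) (large-closed-run-digits large bs loop)))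
  ... | inj₂ (inj₁ small) =
    inj₂ (inj₂ (Product.map₂ (Sign.- ,_) (small-closed-run-digits small bs loop)))
  ... | inj₂ (inj₂ (s , refl)) = Sum.map₂ inj₁ (loop-classification (carry-path {s} {s} _ bs loop))

lemma7p1 : (p f : ℕ) → Prime p → 1 ℕ.≤ f → (r : Vec ℤ f)
    → (∀ (i : Fin f) → (- (+ p) ≤ lookup r i) × (lookup r i ≤ + p))
    → (+ (p ℕ.^ f ∸ 1)) ∣ weightedSum p f r
    → (r ≡ replicate f (+ (p ∸ 1)) ⊎ r ≡ replicate f (- (+ (p ∸ 1))))
      ⊎ (CyclicBlockDecomposition p (toList r)
      ⊎ (p ≡ 2 × (r ≡ replicate f (+ 2) ⊎ r ≡ replicate f (- (+ 2)))))
lemma7p1 0             _       ()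
lemma7p1 1             _       ()
lemma7p1 _             0       _ ()
lemma7p1 (suc (suc a)) (suc n) _ _ r@(_ Vec.∷ _) bounded divisible
  with CarryRun.closed-run (2 ℕ.+ a) r divisible
... | _ , loop
  with BoundedDigits.closed-run-classification a (lookup-All⇒toList-All r bounded) loop
... | inj₁ (Sign.+ , digits)               = inj₁ (inj₁ (toList-All≡⇒replicate r digits))
... | inj₁ (Sign.- , digits)               = inj₁ (inj₂ (toList-All≡⇒replicate r digits))
... | inj₂ (inj₁ cyclic)                   = inj₂ (inj₁ cyclic)
... | inj₂ (inj₂ (refl , Sign.+ , digits)) = inj₂ (inj₂ (refl , inj₁ (toList-All≡⇒replicate r digits)))
... | inj₂ (inj₂ (refl , Sign.- , digits)) = inj₂ (inj₂ (refl , inj₂ (toList-All≡⇒replicate r digits)))
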